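{- Let $G=(V,E)$ be a graph with maximum degree $\Delta$, let $n=|V|$, and let $k$ be a positive integer. Let $c:V\to[k+1]$ be a legal $(k+1)$-coloring of $G$ such that $|V_{c,k+1}|\le |V_{c,i}|$ holds for every $i\in[k+1]$. Let $c'\in\mathcal{R}(c)$ be the random $k$-coloring obtained from $c$ by assigning to each $v\in V_{c,k+1}$ a color $i\in[k]$ chosen from $[k]$ uniformly at random (all vertices outside $V_{c,k+1}$ keeping their colors). Then the expected value of $\rho_k(c')$ is at most $$\frac{n\Delta}{k(k+1)}.$$
   Context: Graphs are finite, simple and undirected; an edge $\{u,v\}$ is written $uv$. For a positive integer $n$, $[n]=\{1,\dots,n\}$. A $k$-coloring of $G=(V,E)$ is a mapping $c:V\to[k]$ (it uses at most $k$ colors, so not every color has to be used). An edge $uv\in E$ is conflicting in $c$ if $c(u)=c(v)$; the coloring $c$ is legal if it has no conflicting edge. For a color $i$, the color class $i$ is $V_{c,i}=\{v\in V : c(v)=i\}$. The set of all $k$-colorings of $G$ (legal or not) is denoted $\mathcal{S}_k$. The penalty function $\rho_k$ on $\mathcal{S}_k$ is the number of conflicting edges: $\rho_k(c)=|\{uv\in E : c(u)=c(v)\}|$. For a legal $(k+1)$-coloring $c$, $\mathcal{R}(c)$ is the set of all $k$-colorings obtained from $c$ by changing the colors of the vertices in $V_{c,k+1}$ to colors in $[k]$ (all other vertices keeping their colors), that is, $$\mathcal{R}(c)=\{c'\in\mathcal{S}_k : \forall i\in[k],\ V_{c',i}\supseteq V_{c,i},\ V_{c',i}\setminus V_{c,i}\subseteq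 V_{c,k+1}\}.$$ -}

module Defs where

open import Algebra.Bundles using (CommutativeRing)
open import Data.Bool.Base using (true; if_then_else_)
open import Data.Empty using (⊥; ⊥-elim)
open import Data.Fin.Base
  using (Fin; zero; suc; inject₁; fromℕ; finToFun; combine; _↑ˡ_; _↑ʳ_)
open import Data.Fin.Properties
  using (_≟_; _<?_; suc-injective; inject₁-injective; fromℕ≢inject₁; remQuot-combine)
open import Data.Fin.Subset using (Subset; _∈_; _⊆_; _⊇_; _─_; ∣_∣)
open import Data.Fin.Subset.Properties using (p─q⊆p)
open import Data.Integer.Base as ℤ using (+_)
import Data.Integer.Properties as ℤ
open import Data.Integer.Tactic.RingSolver using (solve-∀)
open import Data.List.Base using (List; length; filter; map; allFin; cartesianProduct)
open import Data.List.Extrema.Nat using (max)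
open import Data.Nat.Base as ℕ using (ℕ; zero; suc; NonZero)
open import Data.Product.Base using (∃-syntax; _×_; _,_)
open import Data.Rational.Base using (ℚ; 0ℚ; 1ℚ; _+_; _*_; _/_; toℚᵘ; fromℚᵘ)
open import Data.Rational.Properties as ℚ
  using (+-*-commutativeRing; *-1-commutativeMonoid)
open import Data.Rational.Unnormalised.Base as ℚᵘ using (mkℚᵘ; *≡*)
import Data.Rational.Unnormalised.Properties as ℚᵘ
open import Data.Sum.Base using (_⊎_; inj₁; inj₂)
open import Data.Vec.Base using (_∷_; here; there; tabulate)
open import Data.Vec.Properties using (lookup∘tabulate; []=⇒lookup; lookup⇒[]=)
open import Function.Base using (_∘_)
open import Level using (0ℓ)
open import Relation.Binary.Core using (Rel)
open import Relation.Binary.Definitions using (Decidable; Symmetric; Irreflexive)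
open import Relation.Binary.PropositionalEquality
  using (_≡_; _≢_; refl; sym; trans; cong; cong₂; module ≡-Reasoning)
open import Relation.Nullary using (yes; no; does)
open import Relation.Nullary.Decidable using (_×-dec_; dec-true)

open import Algebra.Properties.Semiring.Sum
  (CommutativeRing.semiring +-*-commutativeRing)
  using (sum; sum-syntax; sum-cong-≗; *-distribˡ-sum; *-distribʳ-sum; sum-replicate-zero)
open import Algebra.Properties.CommutativeMonoid.Sum *-1-commutativeMonoid
  using () renaming (sum to product)

private variable
  n k : ℕ

record Graph (n : ℕ) : Set₁ where
  field
    Adj    : Rel (Fin n) 0ℓ
    adj?   : Decidable Adj
    symm   : Symmetric Adj
    irrefl : Irreflexive _≡_ Adj

module _ (G : Graph n) where
  open Graph G

  neighbours : Fin n → Subset n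
  neighbours v = tabulate λ u → does (adj? v u)

  degree : Fin n → ℕ
  degree v = ∣ neighbours v ∣

  -- 0 for the graph without vertices.
  maxDegree : ℕ
  maxDegree = max 0 (map degree (allFin n))

  -- Each edge uv is listed exactly once, as the pair with u < v.
  edges : List (Fin n × Fin n)
  edges = filter (λ (u , v) → (u <? v) ×-dec adj? u v)
                 (cartesianProduct (allFin n) (allFin n))

-- The colors 1, …, k are the elements of Fin k.  As colors of a
-- (k+1)-coloring, they are the elements inject₁ i of Fin (suc k), and the
-- color k+1 is fromℕ k.
Coloring : ℕ → ℕ → Set
Coloring n k = Fin n → Fin k

Legal : Graph n → Coloring n k → Set
Legal G c = ∀ {u v} → Graph.Adj G u v → c u ≢ c v

colorClass : Coloring n k → Fin k → Subset n
colorClass c i = tabulate λ v → does (c v ≟ i)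

ρ : Graph n → Coloring n k → ℕ
ρ G c = length (filter (λ (u , v) → c u ≟ c v) (edges G))

R : Coloring n (suc k) → Coloring n k → Set
R {k = k} c c′ = ∀ (i : Fin k) →
    colorClass c′ i ⊇ colorClass c (inject₁ i)
  × colorClass c′ i ─ colorClass c (inject₁ i) ⊆ colorClass c (fromℕ k)

-- The probability that vertex v receives color i.
vertexProb : .{{NonZero k}} → Coloring n (suc k) → Fin n → Fin k → ℚ
vertexProb {k = k} c v i =
  if does (c v ≟ fromℕ k) then + 1 / k
  else if does (c v ≟ inject₁ i) then 1ℚ
  else 0ℚ

-- The vertices are recolored independently.
prob : .{{NonZero k}} → Coloring n (suc k) → Coloring n k → ℚ
prob c c′ = product λ v → vertexProb c v (c′ v)

-- finToFun enumerates all maps Fin n → Fin k, each exactly once.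
expectation : .{{NonZero k}} → Coloring n (suc k) → (Coloring n k → ℚ) → ℚ
expectation {k = k} {n = n} c X =
  ∑[ j < k ℕ.^ n ] (prob c (finToFun j) * X (finToFun j))

sum-++ : ∀ m {p} (f : Fin (m ℕ.+ p) → ℚ) →
         sum f ≡ sum (λ i → f (i ↑ˡ p)) + sum (λ j → f (m ↑ʳ j))
sum-++ zero    f = sym (ℚ.+-identityˡ _)
sum-++ (suc m) f = trans (cong (λ x → f zero + x) (sum-++ m (f ∘ suc))) (sym (ℚ.+-assoc (f zero) _ _))

sum-combine : ∀ m {p} (f : Fin (m ℕ.* p) → ℚ) →
              sum f ≡ ∑[ i < m ] ∑[ j < p ] f (combine i j)
sum-combine zero        f = refl
sum-combine (suc m) {p} f = trans (sum-++ p f)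
  (cong (λ x → sum (λ j → f (j ↑ˡ (m ℕ.* p))) + x) (sum-combine m (f ∘ (p ↑ʳ_))))

sum-product : ∀ {n k} (w : Fin n → Fin k → ℚ) →
              ∑[ j < k ℕ.^ n ] (product λ v → w v (finToFun j v)) ≡
              product λ v → sum (w v)
sum-product {zero}      w = refl
sum-product {suc n} {k} w = begin
  sum {k ℕ.^ suc n} (λ j → product λ v → w v (finToFun j v))
    ≡⟨ sum-combine k _ ⟩
  sum {k} (λ i → sum {k ℕ.^ n} λ j → product λ v → w v (finToFun (combine i j) v))
    ≡⟨ sum-cong-≗ (λ i → sum-cong-≗ λ j →
         cong₂ (λ (x , _) (_ , y) → w zero x * product λ v → w (suc v) (finToFun y v))
               (remQuot-combine i j) (remQuot-combine i j)) ⟩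
  sum {k} (λ i → sum {k ℕ.^ n} λ j → w zero i * W j)
    ≡⟨ sum-cong-≗ (λ i → *-distribˡ-sum (w zero i) W) ⟨
  sum {k} (λ i → w zero i * sum W)
    ≡⟨ *-distribʳ-sum (sum W) (w zero) ⟨
  sum (w zero) * sum W
    ≡⟨ cong (sum (w zero) *_) (sum-product (w ∘ suc)) ⟩
  (product λ v → sum (w v))
    ∎
  where
  open ≡-Reasoning
  W : Fin (k ℕ.^ n) → ℚ
  W j = product λ v → w (suc v) (finToFun j v)

sum-zero : ∀ {m} (f : Fin m → ℚ) → (∀ i → f i ≡ 0ℚ) → sum f ≡ 0ℚ
sum-zero {m} f f≡0 = trans (sum-cong-≗ f≡0) (sum-replicate-zero m)

sum-single : ∀ {m} (f : Fin m → ℚ) i → (∀ j → j ≢ i → f j ≡ 0ℚ) → sum f ≡ f i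
sum-single f zero    f≡0 = trans
  (cong (λ x → f zero + x) (sum-zero (f ∘ suc) λ j → f≡0 (suc j) λ ()))
  (ℚ.+-identityʳ (f zero))
sum-single f (suc i) f≡0 = trans
  (cong₂ _+_ (f≡0 zero λ ())
             (sum-single (f ∘ suc) i λ j j≢i → f≡0 (suc j) (j≢i ∘ suc-injective)))
  (ℚ.+-identityˡ (f (suc i)))

product-one : ∀ {m} (f : Fin m → ℚ) → (∀ i → f i ≡ 1ℚ) → product f ≡ 1ℚ
product-one {zero}  f f≡1 = refl
product-one {suc m} f f≡1 = cong₂ _*_ (f≡1 zero) (product-one (f ∘ suc) (f≡1 ∘ suc))

product-zero : ∀ {m} (f : Fin m → ℚ) i → f i ≡ 0ℚ → product f ≡ 0ℚ
product-zero f zero    fi≡0 = trans (cong (_* product (f ∘ suc)) fi≡0) (ℚ.*-zeroˡ (product (f ∘ suc)))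
product-zero f (suc i) fi≡0 = trans (cong (f zero *_) (product-zero (f ∘ suc) i fi≡0)) (ℚ.*-zeroʳ (f zero))

sum-const : ∀ m d .{{_ : NonZero d}} → sum {m} (λ _ → + 1 / d) ≡ + m / d
sum-const zero    d@(suc e) = sym (ℚ.fromℚᵘ-cong {mkℚᵘ (+ 0) e} {mkℚᵘ (+ 0) 0} (*≡* refl))
sum-const (suc m) d@(suc e) = trans (cong (λ q → fromℚᵘ x + q) (sum-const m d)) (ℚ.toℚᵘ-injective (begin
  toℚᵘ (fromℚᵘ x + fromℚᵘ y)             ≈⟨ ℚ.toℚᵘ-homo-+ (fromℚᵘ x) (fromℚᵘ y) ⟩
  toℚᵘ (fromℚᵘ x) ℚᵘ.+ toℚᵘ (fromℚᵘ y)   ≈⟨ ℚᵘ.+-cong (ℚ.toℚᵘ-fromℚᵘ x) (ℚ.toℚᵘ-fromℚᵘ y) ⟩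
  x ℚᵘ.+ y                               ≈⟨ *≡* (identity (+ 1) (+ m) (+ d)) ⟩
  z                                      ≈⟨ ℚ.toℚᵘ-fromℚᵘ z ⟨
  toℚᵘ (fromℚᵘ z)                        ∎))
  where
  open import Relation.Binary.Reasoning.Setoid ℚᵘ.≃-setoid
  x = mkℚᵘ (+ 1) e
  y = mkℚᵘ (+ m) e
  z = mkℚᵘ (+ suc m) e
  identity : ∀ a b t → (a ℤ.* t ℤ.+ b ℤ.* t) ℤ.* t ≡ (a ℤ.+ b) ℤ.* (t ℤ.* t)
  identity = solve-∀

n/n≡1 : ∀ d .{{_ : NonZero d}} → + d / d ≡ 1ℚ
n/n≡1 d@(suc e) = ℚ.fromℚᵘ-cong {mkℚᵘ (+ d) e} {mkℚᵘ (+ 1) 0} (*≡* (ℤ.*-comm (+ d) (+ 1)))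

inject₁⁻¹ : ∀ {m} (i : Fin (suc m)) → i ≢ fromℕ m → ∃[ j ] i ≡ inject₁ j
inject₁⁻¹ {zero}  zero    i≢m = ⊥-elim (i≢m refl)
inject₁⁻¹ {suc m} zero    i≢m = zero , refl
inject₁⁻¹ {suc m} (suc i) i≢m =
  let j , i≡j = inject₁⁻¹ i (i≢m ∘ cong suc) in suc j , cong suc i≡j

∈-colorClass⁺ : ∀ (c : Coloring n k) {i v} → c v ≡ i → v ∈ colorClass c i
∈-colorClass⁺ c {i} {v} eq =
  lookup⇒[]= v _ (trans (lookup∘tabulate _ v) (dec-true (c v ≟ i) eq))

∈-colorClass⁻ : ∀ (c : Coloring n k) {i v} → v ∈ colorClass c i → c v ≡ i
∈-colorClass⁻ c {i} {v} v∈ with c v ≟ i | trans (sym (lookup∘tabulate (λ u → does (c u ≟ i)) v)) ([]=⇒lookup v∈)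
... | yes eq | _  = eq
... | no _   | ()

∉─ : ∀ {p q : Subset n} {v} → v ∈ p ─ q → v ∈ q → ⊥
∉─ {p = _ ∷ _} {true ∷ _} () here
∉─ {p = _ ∷ _} {_ ∷ _} (there v∈) (there v∈q) = ∉─ v∈ v∈q

module _ .{{_ : NonZero k}} (c : Coloring n (suc k)) where

  sum-vertexProb : ∀ v → sum (vertexProb c v) ≡ 1ℚ
  sum-vertexProb v with c v ≟ fromℕ k
  ... | yes _    = trans (sum-const k k) (n/n≡1 k)
  ... | no  cv≢k with inject₁⁻¹ (c v) cv≢k
  ...   | i , cv≡i = trans (sum-single _ i off) on
    where
    off : ∀ j → j ≢ i → (if does (c v ≟ inject₁ j) then 1ℚ else 0ℚ) ≡ 0ℚ
    off j j≢i with c v ≟ inject₁ j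
    ... | yes cv≡j = ⊥-elim (j≢i (inject₁-injective (trans (sym cv≡j) cv≡i)))
    ... | no  _    = refl
    on : (if does (c v ≟ inject₁ i) then 1ℚ else 0ℚ) ≡ 1ℚ
    on = cong (λ b → if b then 1ℚ else 0ℚ) (dec-true (c v ≟ inject₁ i) cv≡i)

  prob-total : ∑[ j < k ℕ.^ n ] prob c (finToFun j) ≡ 1ℚ
  prob-total = trans (sum-product (vertexProb c)) (product-one _ sum-vertexProb)

  vertexProb-support : ∀ v i → vertexProb c v i ≢ 0ℚ →
                       c v ≡ fromℕ k ⊎ c v ≡ inject₁ i
  vertexProb-support v i ≢0 with c v ≟ fromℕ k | c v ≟ inject₁ i
  ... | yes eq | _      = inj₁ eq
  ... | no _   | yes eq = inj₂ eq
  ... | no _   | no _   = ⊥-elim (≢0 refl)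

  prob-support : ∀ c′ → prob c c′ ≢ 0ℚ → R c c′
  prob-support c′ ≢0 i = keeps , moves
    where
    from : ∀ v → c v ≡ fromℕ k ⊎ c v ≡ inject₁ (c′ v)
    from v = vertexProb-support v (c′ v) (≢0 ∘ product-zero (λ u → vertexProb c u (c′ u)) v)

    keeps : colorClass c (inject₁ i) ⊆ colorClass c′ i
    keeps {v} v∈ with from v
    ... | inj₁ cv≡k = ⊥-elim (fromℕ≢inject₁ (trans (sym cv≡k) (∈-colorClass⁻ c v∈)))
    ... | inj₂ cv≡  = ∈-colorClass⁺ c′
      (inject₁-injective (trans (sym cv≡) (∈-colorClass⁻ c v∈)))

    moves : colorClass c′ i ─ colorClass c (inject₁ i) ⊆ colorClass c (fromℕ k)
    moves {v} v∈ with from v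
    ... | inj₁ cv≡k = ∈-colorClass⁺ c cv≡k
    ... | inj₂ cv≡  = ⊥-elim (∉─ v∈ (∈-colorClass⁺ c
      (trans cv≡ (cong inject₁ (∈-colorClass⁻ c′ (p─q⊆p _ _ v∈))))))

{-# OPTIONS --safe #-}
-- By legality, an edge in conflict in c′ has exactly one endpoint u of color
-- k+1 in c, and c′ gives u the color of its other endpoint v.  For each of the
-- at most |V_{c,k+1}| Δ pairs (u , v) this has probability 1/k, and
-- (k+1) |V_{c,k+1}| ≤ n because the color class k+1 is a smallest one.
module Submission where

open import Defs
open import Data.Nat.Base as ℕ using (ℕ; suc; NonZero)
open import Data.Nat.Properties using (m*n≢0)
open import Data.Integer.Base using (+_)
open import Data.Rational.Base using (_≤_; _/_)
open import Data.Fin.Base using (Fin; fromℕ)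
open import Data.Fin.Subset using (∣_∣)

open import Algebra.Bundles using (CommutativeRing)
open import Data.Bool.Base using (true; false; if_then_else_)
open import Data.Fin.Base using (zero; suc; inject₁; finToFun)
open import Data.Fin.Properties using (_≟_; _<?_; <-asym; inject₁-injective; suc-injective)
import Data.Integer.Base as ℤ
import Data.Integer.Properties as ℤ
open import Data.Integer.Tactic.RingSolver using (solve-∀)
open import Data.List.Base
  using (List; []; _∷_; _++_; length; filter; map; allFin; tabulate; cartesianProduct)
open import Data.List.Extrema.Nat using (xs≤max)
open import Data.List.Membership.Propositional.Properties using (∈-map⁺; ∈-allFin)
open import Data.List.Properties using (filter-++; length-++; map-tabulate)
import Data.List.Relation.Unary.All as All
open import Data.Nat.Base using (zero; z≤n; s≤s)
import Data.Nat.Properties as ℕ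
open import Data.Product.Base using (_×_; _,_)
open import Data.Rational.Base
  using (ℚ; 0ℚ; 1ℚ; _+_; _*_; NonNegative; toℚᵘ; fromℚᵘ)
open import Data.Rational.Properties as ℚ using (+-*-commutativeRing; *-1-commutativeMonoid)
open import Data.Rational.Unnormalised.Base as ℚᵘ using (mkℚᵘ; *≡*; *≤*)
import Data.Rational.Unnormalised.Properties as ℚᵘ
open import Data.Sum.Base using (_⊎_; inj₁; inj₂)
import Data.Vec.Base as Vec
open import Function.Base using (_∘_; id)
open import Relation.Binary.PropositionalEquality
  using (_≡_; _≢_; refl; sym; trans; cong; cong₂; module ≡-Reasoning)
open import Relation.Nullary using (Dec; yes; no; does; ¬_; contradiction)
open import Relation.Nullary.Decidable using (_×-dec_; dec-true; dec-false)
open import Relation.Unary using (Decidable)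

open import Algebra.Properties.Semiring.Sum ℕ.+-*-semiring
  using () renaming
  ( sum to sumℕ; sum-cong-≗ to sumℕ-cong; ∑-comm to sumℕ-comm
  ; ∑-distrib-+ to sumℕ-distrib-+; *-distribˡ-sum to *-distribˡ-sumℕ
  ; *-distribʳ-sum to *-distribʳ-sumℕ)
open import Algebra.Properties.Semiring.Sum
  (CommutativeRing.semiring +-*-commutativeRing)
  using (sum; sum-cong-≗; ∑-comm; *-distribˡ-sum)
open import Algebra.Properties.CommutativeMonoid.Sum *-1-commutativeMonoid
  using () renaming (sum to product; ∑-distrib-+ to product-distrib-*)

private variable
  m n k : ℕ
  A B C : Set

-- Sums and indicators in ℕ

sumℕ-mono : {f g : Fin m → ℕ} → (∀ i → f i ℕ.≤ g i) → sumℕ f ℕ.≤ sumℕ g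
sumℕ-mono {zero}  f≤g = z≤n
sumℕ-mono {suc m} f≤g = ℕ.+-mono-≤ (f≤g zero) (sumℕ-mono (f≤g ∘ suc))

sumℕ-const : ∀ m b → sumℕ {m} (λ _ → b) ≡ m ℕ.* b
sumℕ-const zero    b = refl
sumℕ-const (suc m) b = cong (b ℕ.+_) (sumℕ-const m b)

-- Branching on `does` alone ties the indicator to the same boolean that `colorClass`, `neighbours`
-- and `filter` test.
𝟙 : Dec A → ℕ
𝟙 a? = if does a? then 1 else 0

𝟙-× : (a? : Dec A) (b? : Dec B) → 𝟙 (a? ×-dec b?) ≡ 𝟙 a? ℕ.* 𝟙 b?
𝟙-× (yes _) b? = sym (ℕ.*-identityˡ (𝟙 b?))
𝟙-× (no _)  b? = refl

𝟙-⊎ : (a? : Dec A) (b? : Dec B) (c? : Dec C) → (A → B ⊎ C) → 𝟙 a? ℕ.≤ 𝟙 b? ℕ.+ 𝟙 c?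
𝟙-⊎ (no _)  _  _  _ = z≤n
𝟙-⊎ (yes a) b? c? f with f a
... | inj₁ b rewrite dec-true b? b = s≤s z≤n
... | inj₂ c rewrite dec-true c? c = ℕ.m≤n+m 1 (𝟙 b?)

𝟙-disjoint : (a? : Dec A) (b? : Dec B) → (A → ¬ B) → 𝟙 a? ℕ.+ 𝟙 b? ℕ.≤ 1
𝟙-disjoint (no _)  (no _)  _ = z≤n
𝟙-disjoint (no _)  (yes _) _ = ℕ.≤-refl
𝟙-disjoint (yes _) (no _)  _ = ℕ.≤-refl
𝟙-disjoint (yes a) (yes b) d = contradiction b (d a)

sumℕ-𝟙≤1 : {P : Fin m → Set} (P? : Decidable P) → (∀ {i j} → P i → P j → i ≡ j) →
           sumℕ (λ i → 𝟙 (P? i)) ℕ.≤ 1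
sumℕ-𝟙≤1 {zero}      P? unique = z≤n
sumℕ-𝟙≤1 {suc m} {P} P? unique with P? zero
... | no _   = sumℕ-𝟙≤1 (P? ∘ suc) (λ p q → suc-injective (unique p q))
-- A witness at `zero` excludes all later indices, so the tail is a sum of zeros.
... | yes p₀ = s≤s (ℕ.≤-reflexive (trans (sumℕ-cong none) (trans (sumℕ-const m 0) (ℕ.*-zeroʳ m))))
  where
  none : ∀ i → 𝟙 (P? (suc i)) ≡ 0
  none i rewrite dec-false (P? (suc i)) (λ p → contradiction (unique p₀ p) λ ()) = refl

-- Counting in subsets and lists by indicator sums.

∣tabulate∣ : {P : Fin n → Set} (P? : Decidable P) →
             ∣ Vec.tabulate (λ v → does (P? v)) ∣ ≡ sumℕ (λ v → 𝟙 (P? v))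
∣tabulate∣ {zero}  P? = refl
∣tabulate∣ {suc n} P? with does (P? zero)
... | true  = cong suc (∣tabulate∣ (P? ∘ suc))
... | false = ∣tabulate∣ (P? ∘ suc)

-- `ρ` filters the list `edges`, itself a filter of all pairs. Merging both tests leaves one filter
-- of the full product, whose length is a double sum.
filter-filter : {P Q : A → Set} (P? : Decidable P) (Q? : Decidable Q) (xs : List A) →
                filter Q? (filter P? xs) ≡ filter (λ x → P? x ×-dec Q? x) xs
filter-filter P? Q? []       = refl
filter-filter P? Q? (x ∷ xs) with does (P? x)
... | false = filter-filter P? Q? xs
... | true with does (Q? x)
...   | false = filter-filter P? Q? xs
...   | true  = cong (x ∷_) (filter-filter P? Q? xs)

length-filter-tabulate : {P : A → Set} (P? : Decidable P) (f : Fin n → A) →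
                         length (filter P? (tabulate f)) ≡ sumℕ (λ i → 𝟙 (P? (f i)))
length-filter-tabulate {n = zero}  P? f = refl
length-filter-tabulate {n = suc n} P? f with does (P? (f zero))
... | true  = cong suc (length-filter-tabulate P? (f ∘ suc))
... | false = length-filter-tabulate P? (f ∘ suc)

-- General `f` and `g` in place of `allFin` let the induction pass to `f ∘ suc`; `allFin` is the
-- case `id`.
length-filter-cartesianProduct :
  {P : A × B → Set} (P? : Decidable P) (f : Fin m → A) (g : Fin n → B) →
  length (filter P? (cartesianProduct (tabulate f) (tabulate g))) ≡
  sumℕ λ i → sumℕ λ j → 𝟙 (P? (f i , g j))
length-filter-cartesianProduct {m = zero}  P? f g = refl
length-filter-cartesianProduct {m = suc m} P? f g = begin
  length (filter P? (row ++ rest))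
    ≡⟨ cong length (filter-++ P? row rest) ⟩
  length (filter P? row ++ filter P? rest)
    ≡⟨ length-++ (filter P? row) ⟩
  length (filter P? row) ℕ.+ length (filter P? rest)
    ≡⟨ cong₂ ℕ._+_
         (trans (cong (length ∘ filter P?) (map-tabulate g (f zero ,_)))
                (length-filter-tabulate P? (λ j → f zero , g j)))
         (length-filter-cartesianProduct P? (f ∘ suc) g) ⟩
  (sumℕ λ i → sumℕ λ j → 𝟙 (P? (f i , g j)))
    ∎
  where
  open ≡-Reasoning
  row  = map (f zero ,_) (tabulate g)
  rest = cartesianProduct (tabulate (f ∘ suc)) (tabulate g)

-- Exchanging the names of `u` and `v` in the terms `t v u` gives each `t u v` the weight
-- `𝟙 (u <? v) + 𝟙 (v <? u)`, which is at most 1 by asymmetry. Only the diagonal terms are lost.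
sumℕ-unordered≤ordered : (t : Fin n → Fin n → ℕ) →
  (sumℕ λ u → sumℕ λ v → 𝟙 (u <? v) ℕ.* (t u v ℕ.+ t v u)) ℕ.≤ (sumℕ λ u → sumℕ λ v → t u v)
sumℕ-unordered≤ordered t = begin
  (sumℕ λ u → sumℕ λ v → 𝟙 (u <? v) ℕ.* (t u v ℕ.+ t v u))
    ≡⟨ sumℕ-cong (λ u → trans
         (sumℕ-cong λ v → ℕ.*-distribˡ-+ (𝟙 (u <? v)) (t u v) (t v u))
         (sumℕ-distrib-+ (λ v → 𝟙 (u <? v) ℕ.* t u v) (λ v → 𝟙 (u <? v) ℕ.* t v u))) ⟩
  (sumℕ λ u → (sumℕ λ v → 𝟙 (u <? v) ℕ.* t u v) ℕ.+ (sumℕ λ v → 𝟙 (u <? v) ℕ.* t v u))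
    ≡⟨ sumℕ-distrib-+ (λ u → sumℕ λ v → 𝟙 (u <? v) ℕ.* t u v)
                      (λ u → sumℕ λ v → 𝟙 (u <? v) ℕ.* t v u) ⟩
  (sumℕ λ u → sumℕ λ v → 𝟙 (u <? v) ℕ.* t u v) ℕ.+ (sumℕ λ u → sumℕ λ v → 𝟙 (u <? v) ℕ.* t v u)
    ≡⟨ cong ((sumℕ λ u → sumℕ λ v → 𝟙 (u <? v) ℕ.* t u v) ℕ.+_)
            (sumℕ-comm λ u v → 𝟙 (u <? v) ℕ.* t v u) ⟩
  (sumℕ λ u → sumℕ λ v → 𝟙 (u <? v) ℕ.* t u v) ℕ.+ (sumℕ λ u → sumℕ λ v → 𝟙 (v <? u) ℕ.* t u v)
    ≡⟨ sumℕ-distrib-+ (λ u → sumℕ λ v → 𝟙 (u <? v) ℕ.* t u v)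
                      (λ u → sumℕ λ v → 𝟙 (v <? u) ℕ.* t u v) ⟨
  (sumℕ λ u → (sumℕ λ v → 𝟙 (u <? v) ℕ.* t u v) ℕ.+ (sumℕ λ v → 𝟙 (v <? u) ℕ.* t u v))
    ≡⟨ sumℕ-cong (λ u → sumℕ-distrib-+ (λ v → 𝟙 (u <? v) ℕ.* t u v) (λ v → 𝟙 (v <? u) ℕ.* t u v)) ⟨
  (sumℕ λ u → sumℕ λ v → 𝟙 (u <? v) ℕ.* t u v ℕ.+ 𝟙 (v <? u) ℕ.* t u v)
    ≤⟨ sumℕ-mono (λ u → sumℕ-mono λ v → once u v) ⟩
  (sumℕ λ u → sumℕ λ v → t u v)
    ∎
  where
  open ℕ.≤-Reasoning
  once : ∀ u v → 𝟙 (u <? v) ℕ.* t u v ℕ.+ 𝟙 (v <? u) ℕ.* t u v ℕ.≤ t u v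
  once u v = begin
    𝟙 (u <? v) ℕ.* t u v ℕ.+ 𝟙 (v <? u) ℕ.* t u v
      ≡⟨ ℕ.*-distribʳ-+ (t u v) (𝟙 (u <? v)) (𝟙 (v <? u)) ⟨
    (𝟙 (u <? v) ℕ.+ 𝟙 (v <? u)) ℕ.* t u v
      ≤⟨ ℕ.*-monoˡ-≤ (t u v) (𝟙-disjoint (u <? v) (v <? u) <-asym) ⟩
    1 ℕ.* t u v
      ≡⟨ ℕ.*-identityˡ (t u v) ⟩
    t u v
      ∎

-- Rational sums and products

-- Unfolds to the form in which the theorem casts `ρ G c′`.
fromℕℚ : ℕ → ℚ
fromℕℚ a = + a / 1

fromℕℚ-+ : ∀ a b → fromℕℚ (a ℕ.+ b) ≡ fromℕℚ a + fromℕℚ b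
fromℕℚ-+ a b = ℚ.toℚᵘ-injective (begin
  toℚᵘ (fromℚᵘ (x +′ y))                ≈⟨ ℚ.toℚᵘ-fromℚᵘ (x +′ y) ⟩
  x +′ y                                ≈⟨ *≡* (identity (+ a) (+ b)) ⟩
  x ℚᵘ.+ y                              ≈⟨ ℚᵘ.+-cong (ℚ.toℚᵘ-fromℚᵘ x) (ℚ.toℚᵘ-fromℚᵘ y) ⟨
  toℚᵘ (fromℚᵘ x) ℚᵘ.+ toℚᵘ (fromℚᵘ y)  ≈⟨ ℚ.toℚᵘ-homo-+ (fromℚᵘ x) (fromℚᵘ y) ⟨
  toℚᵘ (fromℚᵘ x + fromℚᵘ y)            ∎)
  where
  open import Relation.Binary.Reasoning.Setoid ℚᵘ.≃-setoid
  x = mkℚᵘ (+ a) 0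
  y = mkℚᵘ (+ b) 0
  -- Adds numerators over the common denominator 1, so that `fromℚᵘ (x +′ y)` is `fromℕℚ (a + b)` by
  -- computation; `ℚᵘ.+` would leave factors 1 in the numerator.
  _+′_ : ℚᵘ.ℚᵘ → ℚᵘ.ℚᵘ → ℚᵘ.ℚᵘ
  p +′ q = mkℚᵘ (ℚᵘ.↥ p ℤ.+ ℚᵘ.↥ q) 0
  identity : ∀ a b → (a ℤ.+ b) ℤ.* (+ 1) ≡ (a ℤ.* + 1 ℤ.+ b ℤ.* + 1) ℤ.* + 1
  identity = solve-∀

fromℚᵘ-mono-≤ : ∀ {p q} → p ℚᵘ.≤ q → fromℚᵘ p ≤ fromℚᵘ q
fromℚᵘ-mono-≤ {p} {q} p≤q = ℚ.toℚᵘ-cancel-≤ (begin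
  toℚᵘ (fromℚᵘ p)  ≃⟨ ℚ.toℚᵘ-fromℚᵘ p ⟩
  p                ≤⟨ p≤q ⟩
  q                ≃⟨ ℚ.toℚᵘ-fromℚᵘ q ⟨
  toℚᵘ (fromℚᵘ q)  ∎)
  where open ℚᵘ.≤-Reasoning

fromℕℚ-mono : ∀ {a b} → a ℕ.≤ b → fromℕℚ a ≤ fromℕℚ b
fromℕℚ-mono {a} {b} a≤b =
  fromℚᵘ-mono-≤ {mkℚᵘ (+ a) 0} {mkℚᵘ (+ b) 0} (*≤* (ℤ.*-monoʳ-≤-nonNeg (+ 1) (ℤ.+≤+ a≤b)))

fromℕℚ-sum : (f : Fin m → ℕ) → fromℕℚ (sumℕ f) ≡ sum (λ i → fromℕℚ (f i))
fromℕℚ-sum {zero}  f = refl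
fromℕℚ-sum {suc m} f = trans (fromℕℚ-+ (f zero) (sumℕ (f ∘ suc)))
                             (cong (λ q → fromℕℚ (f zero) + q) (fromℕℚ-sum (f ∘ suc)))

1/d*a≤b/[d*e] : ∀ a b d e .{{_ : NonZero d}} .{{_ : NonZero e}} → e ℕ.* a ℕ.≤ b →
                + 1 / d * fromℕℚ a ≤ _/_ (+ b) (d ℕ.* e) {{m*n≢0 d e}}
1/d*a≤b/[d*e] a b d@(suc d-1) e@(suc e-1) ea≤b = ℚ.toℚᵘ-cancel-≤ (begin
  toℚᵘ (fromℚᵘ x * fromℚᵘ y)            ≃⟨ ℚ.toℚᵘ-homo-* (fromℚᵘ x) (fromℚᵘ y) ⟩
  toℚᵘ (fromℚᵘ x) ℚᵘ.* toℚᵘ (fromℚᵘ y)  ≃⟨ ℚᵘ.*-cong (ℚ.toℚᵘ-fromℚᵘ x) (ℚ.toℚᵘ-fromℚᵘ y) ⟩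
  x ℚᵘ.* y                              ≤⟨ *≤* cross ⟩
  z                                     ≃⟨ ℚ.toℚᵘ-fromℚᵘ z ⟨
  toℚᵘ (fromℚᵘ z)                       ∎)
  where
  open ℚᵘ.≤-Reasoning
  x = mkℚᵘ (+ 1) d-1
  y = mkℚᵘ (+ a) 0
  -- `mkℚᵘ` takes the denominator minus one; `d * e` is positive, so `pred` is exact here.
  z = mkℚᵘ (+ b) (ℕ.pred (d ℕ.* e))
  left : ∀ a d e → (+ 1 ℤ.* a) ℤ.* (d ℤ.* e) ≡ (e ℤ.* a) ℤ.* (d ℤ.* + 1)
  left = solve-∀
  cross : (+ 1 ℤ.* + a) ℤ.* + (d ℕ.* e) ℤ.≤ + b ℤ.* + (d ℕ.* 1)
  -- Regrouped, the left side is `(e * a) * (d * 1)`, so the claim is the hypothesis multiplied by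
  -- `d`.
  cross = ℤ.≤-trans
    (ℤ.≤-reflexive (trans (cong ((+ 1 ℤ.* + a) ℤ.*_) (ℤ.pos-* d e))
      (trans (left (+ a) (+ d) (+ e))
             (cong₂ ℤ._*_ (sym (ℤ.pos-* e a)) (sym (ℤ.pos-* d 1))))))
    (ℤ.*-monoʳ-≤-nonNeg (+ (d ℕ.* 1)) (ℤ.+≤+ ea≤b))

sum-mono : {f g : Fin m → ℚ} → (∀ i → f i ≤ g i) → sum f ≤ sum g
sum-mono {zero}  f≤g = ℚ.≤-refl
sum-mono {suc m} f≤g = ℚ.+-mono-≤ (f≤g zero) (sum-mono (f≤g ∘ suc))

product-nonNeg : (f : Fin m → ℚ) → (∀ i → NonNegative (f i)) → NonNegative (product f)
product-nonNeg {zero}  f f≥0 = _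
product-nonNeg {suc m} f f≥0 =
  ℚ.nonNeg*nonNeg⇒nonNeg (f zero) {{f≥0 zero}}
    (product (f ∘ suc)) {{product-nonNeg (f ∘ suc) (f≥0 ∘ suc)}}

product-single : (f : Fin m → ℚ) (i : Fin m) → (∀ j → j ≢ i → f j ≡ 1ℚ) → product f ≡ f i
product-single f zero    f≡1 = trans
  (cong (f zero *_) (product-one (f ∘ suc) λ j → f≡1 (suc j) λ ()))
  (ℚ.*-identityʳ (f zero))
product-single f (suc i) f≡1 = trans
  (cong₂ _*_ (f≡1 zero λ ())
             (product-single (f ∘ suc) i λ j j≢i → f≡1 (suc j) (j≢i ∘ suc-injective)))
  (ℚ.*-identityˡ (f (suc i)))

-- X (f u) is turned into a product over all v, whose factor at v is 1 unless
-- v = u, so that sum-product applies.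
sum-product-marginal : (w : Fin n → Fin k → ℚ) → (∀ v → sum (w v) ≡ 1ℚ) →
  (u : Fin n) (X : Fin k → ℚ) →
  sum {k ℕ.^ n} (λ j → product (λ v → w v (finToFun j v)) * X (finToFun j u)) ≡
  sum (λ i → w u i * X i)
sum-product-marginal {n} {k} w total u X = begin
  sum {k ℕ.^ n} (λ j → product (λ v → w v (finToFun j v)) * X (finToFun j u))
    ≡⟨ sum-cong-≗ (λ j → cong (product (λ v → w v (finToFun j v)) *_) (spread (finToFun j))) ⟨
  sum {k ℕ.^ n} (λ j → product (λ v → w v (finToFun j v)) * product (λ v → at v (finToFun j v)))
    ≡⟨ sum-cong-≗ {k ℕ.^ n} (λ j →
         product-distrib-* (λ v → w v (finToFun j v)) (λ v → at v (finToFun j v))) ⟨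
  sum {k ℕ.^ n} (λ j → product (λ v → w v (finToFun j v) * at v (finToFun j v)))
    ≡⟨ sum-product (λ v i → w v i * at v i) ⟩
  product (λ v → sum (λ i → w v i * at v i))
    ≡⟨ product-single (λ v → sum (λ i → w v i * at v i)) u (λ v v≢u →
         trans (sum-cong-≗ λ i → trans (cong (w v i *_) (at-≢ v≢u i)) (ℚ.*-identityʳ (w v i)))
               (total v)) ⟩
  sum (λ i → w u i * at u i)
    ≡⟨ sum-cong-≗ (λ i → cong (w u i *_) (at-≡ i)) ⟩
  sum (λ i → w u i * X i)
    ∎
  where
  open ≡-Reasoning
  at : Fin n → Fin k → ℚ
  at v i = if does (v ≟ u) then X i else 1ℚ
  at-≡ : ∀ i → at u i ≡ X i
  at-≡ i = cong (λ b → if b then X i else 1ℚ) (dec-true (u ≟ u) refl)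
  at-≢ : ∀ {v} → v ≢ u → ∀ i → at v i ≡ 1ℚ
  at-≢ {v} v≢u i = cong (λ b → if b then X i else 1ℚ) (dec-false (v ≟ u) v≢u)
  spread : ∀ f → product (λ v → at v (f v)) ≡ X (f u)
  spread f = trans (product-single (λ v → at v (f v)) u (λ v v≢u → at-≢ v≢u (f v))) (at-≡ (f u))

-- Expectation

module _ .{{_ : NonZero k}} (c : Coloring n (suc k)) where

  vertexProb-nonNeg : ∀ v i → NonNegative (vertexProb c v i)
  vertexProb-nonNeg v i with does (c v ≟ fromℕ k) | does (c v ≟ inject₁ i)
  ... | true  | _     = ℚ.normalize-nonNeg 1 k
  ... | false | true  = _
  ... | false | false = _

  -- A comparison on `R c` suffices: any other coloring has probability 0 by `prob-support`, and
  -- contributes 0 to both sides.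
  expectation-mono : {X Y : Coloring n k → ℚ} →
                     (∀ c′ → R c c′ → X c′ ≤ Y c′) → expectation c X ≤ expectation c Y
  expectation-mono {X} {Y} X≤Y = sum-mono (mono ∘ finToFun)
    where
    mono : ∀ c′ → prob c c′ * X c′ ≤ prob c c′ * Y c′
    mono c′ with prob c c′ ℚ.≟ 0ℚ
    ... | yes p≡0 rewrite p≡0 = ℚ.≤-reflexive (trans (ℚ.*-zeroˡ (X c′)) (sym (ℚ.*-zeroˡ (Y c′))))
    ... | no  p≢0 = ℚ.*-monoˡ-≤-nonNeg (prob c c′)
      {{product-nonNeg _ (λ v → vertexProb-nonNeg v (c′ v))}} (X≤Y c′ (prob-support c c′ p≢0))

  -- Linearity of expectation, by exchanging two finite sums.
  expectation-sum : (X : Fin m → Coloring n k → ℚ) →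
                    expectation c (λ c′ → sum (λ u → X u c′)) ≡ sum (λ u → expectation c (X u))
  expectation-sum X = trans
    (sum-cong-≗ λ j → *-distribˡ-sum (prob c (finToFun j)) (λ u → X u (finToFun j)))
    (∑-comm λ j u → prob c (finToFun j) * X u (finToFun j))

  expectation-marginal : ∀ u (X : Fin k → ℚ) →
                         expectation c (λ c′ → X (c′ u)) ≡ sum (λ i → vertexProb c u i * X i)
  expectation-marginal = sum-product-marginal (vertexProb c) (sum-vertexProb c)

-- Conflicts

module _ (c : Coloring n (suc k)) (c′ : Coloring n k) (c′∈R : R c c′) where

  R-keeps : ∀ {v i} → c v ≡ inject₁ i → c′ v ≡ i
  R-keeps {v} {i} cv≡i =
    let keeps , _ = c′∈R i in ∈-colorClass⁻ c′ (keeps (∈-colorClass⁺ c cv≡i))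

  -- A color other than k+1 has the form `inject₁ i`, and `c′` keeps this `i`.
  R-cases : ∀ v → c v ≢ fromℕ k → c v ≡ inject₁ (c′ v)
  R-cases v cv≢k with inject₁⁻¹ (c v) cv≢k
  ... | i , cv≡i = trans cv≡i (cong inject₁ (sym (R-keeps cv≡i)))

-- Charging conflicting edges to threats.

module _ (G : Graph n) where
  open Graph G

  degree≤maxDegree : ∀ v → degree G v ℕ.≤ maxDegree G
  degree≤maxDegree v = All.lookup (xs≤max 0 (map (degree G) (allFin n)))
                                  (∈-map⁺ (degree G) (∈-allFin v))

  module _ (c : Coloring n (suc k)) where

    -- Giving u the color i would put the edge uv in conflict.
    Threat : Fin n → Fin n → Fin k → Set
    Threat u v i = c u ≡ fromℕ k × Adj u v × c v ≡ inject₁ i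

    threat? : ∀ u v i → Dec (Threat u v i)
    threat? u v i = (c u ≟ fromℕ k) ×-dec (adj? u v ×-dec (c v ≟ inject₁ i))

    -- The number of neighbours of `u` of color `i` if `u` has color k+1, and 0 otherwise. It
    -- depends on `c` only, so that in `threats u (c′ u)` chance enters through the color of `u`
    -- alone.
    threats : Fin n → Fin k → ℕ
    threats u i = sumℕ λ v → 𝟙 (threat? u v i)

    -- If both endpoints had color k+1, `c` would not be legal. If neither had, both would keep
    -- their colors and already conflict in `c`. Otherwise the endpoint of color k+1 received the
    -- color of the other one.
    conflict⇒threat : Legal G c → ∀ c′ → R c c′ → ∀ {u v} → Adj u v → c′ u ≡ c′ v →
                      Threat u v (c′ u) ⊎ Threat v u (c′ v)
    conflict⇒threat legal c′ c′∈R {u} {v} uv eq with c u ≟ fromℕ k | c v ≟ fromℕ k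
    ... | yes cu≡k | yes cv≡k = contradiction (trans cu≡k (sym cv≡k)) (legal uv)
    ... | yes cu≡k | no  cv≢k =
      inj₁ (cu≡k , uv , trans (R-cases c c′ c′∈R v cv≢k) (cong inject₁ (sym eq)))
    ... | no  cu≢k | yes cv≡k =
      inj₂ (cv≡k , symm uv , trans (R-cases c c′ c′∈R u cu≢k) (cong inject₁ eq))
    ... | no  cu≢k | no  cv≢k = contradiction
      (trans (R-cases c c′ c′∈R u cu≢k) (trans (cong inject₁ eq) (sym (R-cases c c′ c′∈R v cv≢k))))
      (legal uv)

    ρ≤threats : Legal G c → ∀ c′ → R c c′ → ρ G c′ ℕ.≤ sumℕ λ u → threats u (c′ u)
    ρ≤threats legal c′ c′∈R = begin
      ρ G c′
        ≡⟨ cong length (filter-filter edge? same? (cartesianProduct (allFin n) (allFin n))) ⟩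
      length (filter (λ e → edge? e ×-dec same? e) (cartesianProduct (allFin n) (allFin n)))
        ≡⟨ length-filter-cartesianProduct (λ e → edge? e ×-dec same? e) id id ⟩
      (sumℕ λ u → sumℕ λ v → 𝟙 (edge? (u , v) ×-dec same? (u , v)))
        ≤⟨ sumℕ-mono (λ u → sumℕ-mono λ v → charge u v) ⟩
      (sumℕ λ u → sumℕ λ v → 𝟙 (u <? v) ℕ.* (t u v ℕ.+ t v u))
        ≤⟨ sumℕ-unordered≤ordered t ⟩
      (sumℕ λ u → threats u (c′ u))
        ∎
      where
      open ℕ.≤-Reasoning
      edge? = λ ((u , v) : Fin n × Fin n) → (u <? v) ×-dec adj? u v
      same? = λ ((u , v) : Fin n × Fin n) → c′ u ≟ c′ v
      t : Fin n → Fin n → ℕ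
      t u v = 𝟙 (threat? u v (c′ u))
      charge : ∀ u v → 𝟙 (edge? (u , v) ×-dec same? (u , v)) ℕ.≤ 𝟙 (u <? v) ℕ.* (t u v ℕ.+ t v u)
      charge u v = begin
        𝟙 (((u <? v) ×-dec adj? u v) ×-dec (c′ u ≟ c′ v))
          ≡⟨ 𝟙-× ((u <? v) ×-dec adj? u v) (c′ u ≟ c′ v) ⟩
        𝟙 ((u <? v) ×-dec adj? u v) ℕ.* 𝟙 (c′ u ≟ c′ v)
          ≡⟨ cong (ℕ._* 𝟙 (c′ u ≟ c′ v)) (𝟙-× (u <? v) (adj? u v)) ⟩
        𝟙 (u <? v) ℕ.* 𝟙 (adj? u v) ℕ.* 𝟙 (c′ u ≟ c′ v)
          ≡⟨ ℕ.*-assoc (𝟙 (u <? v)) _ _ ⟩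
        𝟙 (u <? v) ℕ.* (𝟙 (adj? u v) ℕ.* 𝟙 (c′ u ≟ c′ v))
          ≡⟨ cong (𝟙 (u <? v) ℕ.*_) (𝟙-× (adj? u v) (c′ u ≟ c′ v)) ⟨
        𝟙 (u <? v) ℕ.* 𝟙 (adj? u v ×-dec (c′ u ≟ c′ v))
          -- The factor `𝟙 (u <? v)` stays outside, since it is what makes the two orientations of
          -- an edge combine without double counting in `sumℕ-unordered≤ordered`.
          ≤⟨ ℕ.*-monoʳ-≤ (𝟙 (u <? v))
               (𝟙-⊎ (adj? u v ×-dec (c′ u ≟ c′ v)) (threat? u v (c′ u)) (threat? v u (c′ v))
                    (λ (uv , eq) → conflict⇒threat legal c′ c′∈R uv eq)) ⟩
        𝟙 (u <? v) ℕ.* (t u v ℕ.+ t v u)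
          ∎

    -- Since `v` has a single color, a pair `(u , v)` is a threat for at most one `i`. Hence a
    -- vertex `u` of color k+1 contributes at most its degree, and any other vertex contributes 0.
    sum-threats≤ : (sumℕ λ u → sumℕ λ i → threats u i) ℕ.≤ ∣ colorClass c (fromℕ k) ∣ ℕ.* maxDegree G
    sum-threats≤ = begin
      (sumℕ λ u → sumℕ λ i → threats u i)
        ≤⟨ sumℕ-mono perVertex ⟩
      (sumℕ λ u → 𝟙 (c u ≟ fromℕ k) ℕ.* maxDegree G)
        ≡⟨ *-distribʳ-sumℕ (maxDegree G) (λ u → 𝟙 (c u ≟ fromℕ k)) ⟨
      (sumℕ λ u → 𝟙 (c u ≟ fromℕ k)) ℕ.* maxDegree G
        ≡⟨ cong (ℕ._* maxDegree G) (∣tabulate∣ (λ u → c u ≟ fromℕ k)) ⟨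
      ∣ colorClass c (fromℕ k) ∣ ℕ.* maxDegree G
        ∎
      where
      open ℕ.≤-Reasoning
      perPair : ∀ u v → (sumℕ λ i → 𝟙 (threat? u v i)) ℕ.≤ 𝟙 (c u ≟ fromℕ k) ℕ.* 𝟙 (adj? u v)
      perPair u v = begin
        (sumℕ λ i → 𝟙 (threat? u v i))
          ≡⟨ sumℕ-cong (λ i → trans
               (𝟙-× (c u ≟ fromℕ k) (adj? u v ×-dec (c v ≟ inject₁ i)))
               (trans (cong (𝟙 (c u ≟ fromℕ k) ℕ.*_) (𝟙-× (adj? u v) (c v ≟ inject₁ i)))
                      (sym (ℕ.*-assoc (𝟙 (c u ≟ fromℕ k)) _ _)))) ⟩
        (sumℕ λ i → 𝟙 (c u ≟ fromℕ k) ℕ.* 𝟙 (adj? u v) ℕ.* 𝟙 (c v ≟ inject₁ i))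
          ≡⟨ *-distribˡ-sumℕ (𝟙 (c u ≟ fromℕ k) ℕ.* 𝟙 (adj? u v)) (λ i → 𝟙 (c v ≟ inject₁ i)) ⟨
        𝟙 (c u ≟ fromℕ k) ℕ.* 𝟙 (adj? u v) ℕ.* (sumℕ λ i → 𝟙 (c v ≟ inject₁ i))
          ≤⟨ ℕ.*-monoʳ-≤ (𝟙 (c u ≟ fromℕ k) ℕ.* 𝟙 (adj? u v))
               (sumℕ-𝟙≤1 (λ i → c v ≟ inject₁ i) (λ p q → inject₁-injective (trans (sym p) q))) ⟩
        𝟙 (c u ≟ fromℕ k) ℕ.* 𝟙 (adj? u v) ℕ.* 1
          ≡⟨ ℕ.*-identityʳ _ ⟩
        𝟙 (c u ≟ fromℕ k) ℕ.* 𝟙 (adj? u v)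
          ∎
      perVertex : ∀ u → (sumℕ λ i → threats u i) ℕ.≤ 𝟙 (c u ≟ fromℕ k) ℕ.* maxDegree G
      perVertex u = begin
        (sumℕ λ i → threats u i)
          ≡⟨ sumℕ-comm (λ i v → 𝟙 (threat? u v i)) ⟩
        (sumℕ λ v → sumℕ λ i → 𝟙 (threat? u v i))
          ≤⟨ sumℕ-mono (perPair u) ⟩
        (sumℕ λ v → 𝟙 (c u ≟ fromℕ k) ℕ.* 𝟙 (adj? u v))
          ≡⟨ *-distribˡ-sumℕ (𝟙 (c u ≟ fromℕ k)) (λ v → 𝟙 (adj? u v)) ⟨
        𝟙 (c u ≟ fromℕ k) ℕ.* (sumℕ λ v → 𝟙 (adj? u v))
          ≡⟨ cong (𝟙 (c u ≟ fromℕ k) ℕ.*_) (∣tabulate∣ (adj? u)) ⟨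
        𝟙 (c u ≟ fromℕ k) ℕ.* degree G u
          ≤⟨ ℕ.*-monoʳ-≤ (𝟙 (c u ≟ fromℕ k)) (degree≤maxDegree u) ⟩
        𝟙 (c u ≟ fromℕ k) ℕ.* maxDegree G
          ∎

    -- Here the probability 1/k enters. The formula also covers vertices outside class k+1, whose
    -- colors are not uniform, because all their threats are 0.
    expectation-threats : .{{_ : NonZero k}} → ∀ u →
      expectation c (λ c′ → fromℕℚ (threats u (c′ u))) ≡ + 1 / k * fromℕℚ (sumℕ (threats u))
    expectation-threats u = begin
      expectation c (λ c′ → fromℕℚ (threats u (c′ u)))
        ≡⟨ expectation-marginal c u (fromℕℚ ∘ threats u) ⟩
      sum (λ i → vertexProb c u i * fromℕℚ (threats u i))
        ≡⟨ sum-cong-≗ uniform ⟩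
      sum (λ i → + 1 / k * fromℕℚ (threats u i))
        ≡⟨ *-distribˡ-sum (+ 1 / k) (fromℕℚ ∘ threats u) ⟨
      + 1 / k * sum (fromℕℚ ∘ threats u)
        ≡⟨ cong (+ 1 / k *_) (fromℕℚ-sum (threats u)) ⟨
      + 1 / k * fromℕℚ (sumℕ (threats u))
        ∎
      where
      open ≡-Reasoning
      uniform : ∀ i → vertexProb c u i * fromℕℚ (threats u i) ≡ + 1 / k * fromℕℚ (threats u i)
      uniform i with c u ≟ fromℕ k
      ... | yes _ = refl
      -- Every indicator in `threats u i` has now reduced to 0, and the rewrite evaluates the sum of
      -- `n` zeros.
      ... | no _ rewrite trans (sumℕ-const n 0) (ℕ.*-zeroʳ n) =
        trans (ℚ.*-zeroʳ (if does (c u ≟ inject₁ i) then 1ℚ else 0ℚ)) (sym (ℚ.*-zeroʳ (+ 1 / k)))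

-- Double counting of the pairs of a vertex and its color: the class sizes add up to at most `n`,
-- and each of the `k` classes is at least as large as class `i`.
smallest-class-bound : (c : Coloring n k) (i : Fin k) →
  (∀ j → ∣ colorClass c i ∣ ℕ.≤ ∣ colorClass c j ∣) → k ℕ.* ∣ colorClass c i ∣ ℕ.≤ n
smallest-class-bound {n} {k} c i smallest = begin
  k ℕ.* ∣ colorClass c i ∣                    ≡⟨ sumℕ-const k _ ⟨
  sumℕ {k} (λ _ → ∣ colorClass c i ∣)         ≤⟨ sumℕ-mono smallest ⟩
  sumℕ (λ j → ∣ colorClass c j ∣)             ≡⟨ sumℕ-cong (λ j → ∣tabulate∣ (λ v → c v ≟ j)) ⟩
  (sumℕ λ j → sumℕ λ v → 𝟙 (c v ≟ j))         ≡⟨ sumℕ-comm (λ j v → 𝟙 (c v ≟ j)) ⟩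
  (sumℕ λ v → sumℕ λ j → 𝟙 (c v ≟ j))         ≤⟨ sumℕ-mono (λ v → sumℕ-𝟙≤1 (c v ≟_) (λ p q → trans (sym p) q)) ⟩
  sumℕ {n} (λ _ → 1)                          ≡⟨ trans (sumℕ-const n 1) (ℕ.*-identityʳ n) ⟩
  n                                           ∎
  where open ℕ.≤-Reasoning

-- The expected number of conflicting edges.

proposition2 : (n : ℕ) (G : Graph n) (k : ℕ) .{{_ : NonZero k}}
    (c : Coloring n (suc k)) → Legal G c →
    (∀ (i : Fin (suc k)) → ∣ colorClass c (fromℕ k) ∣ ℕ.≤ ∣ colorClass c i ∣) →
    expectation c (λ c′ → + (ρ G c′) / 1) ≤
    _/_ (+ (n ℕ.* maxDegree G)) (k ℕ.* suc k) {{m*n≢0 k (suc k)}}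
proposition2 n G k c legal smallest = begin
  expectation c (λ c′ → fromℕℚ (ρ G c′))
    ≤⟨ expectation-mono c (λ c′ c′∈R → fromℕℚ-mono (ρ≤threats G c legal c′ c′∈R)) ⟩
  expectation c (λ c′ → fromℕℚ (sumℕ λ u → h u (c′ u)))
    -- The cast moves inside the sum over `u`, so that linearity can isolate terms that depend on
    -- one vertex's color each.
    ≡⟨ sum-cong-≗ (λ j → cong (prob c (finToFun j) *_) (fromℕℚ-sum λ u → h u (finToFun j u))) ⟩
  expectation c (λ c′ → sum λ u → fromℕℚ (h u (c′ u)))
    ≡⟨ expectation-sum c (λ u c′ → fromℕℚ (h u (c′ u))) ⟩
  sum (λ u → expectation c (λ c′ → fromℕℚ (h u (c′ u))))
    ≡⟨ sum-cong-≗ (expectation-threats G c) ⟩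
  sum (λ u → + 1 / k * fromℕℚ (sumℕ (h u)))
    ≡⟨ *-distribˡ-sum (+ 1 / k) (λ u → fromℕℚ (sumℕ (h u))) ⟨
  + 1 / k * sum (λ u → fromℕℚ (sumℕ (h u)))
    ≡⟨ cong (+ 1 / k *_) (fromℕℚ-sum λ u → sumℕ (h u)) ⟨
  + 1 / k * fromℕℚ (sumℕ λ u → sumℕ (h u))
    -- The factor 1/k comes from the random color; the factor 1/(k+1) comes from the class size,
    -- through `total`.
    ≤⟨ 1/d*a≤b/[d*e] (sumℕ λ u → sumℕ (h u)) (n ℕ.* maxDegree G) k (suc k) total ⟩
  _/_ (+ (n ℕ.* maxDegree G)) (k ℕ.* suc k) {{m*n≢0 k (suc k)}}
    ∎
  where
  h : Fin n → Fin k → ℕ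
  h = threats G c
  total : suc k ℕ.* (sumℕ λ u → sumℕ (h u)) ℕ.≤ n ℕ.* maxDegree G
  total = begin
    suc k ℕ.* (sumℕ λ u → sumℕ (h u))
      ≤⟨ ℕ.*-monoʳ-≤ (suc k) (sum-threats≤ G c) ⟩
    suc k ℕ.* (∣ colorClass c (fromℕ k) ∣ ℕ.* maxDegree G)
      ≡⟨ ℕ.*-assoc (suc k) ∣ colorClass c (fromℕ k) ∣ (maxDegree G) ⟨
    suc k ℕ.* ∣ colorClass c (fromℕ k) ∣ ℕ.* maxDegree G
      ≤⟨ ℕ.*-monoˡ-≤ (maxDegree G) (smallest-class-bound c (fromℕ k) smallest) ⟩
    n ℕ.* maxDegree G
      ∎
    where open ℕ.≤-Reasoning
  open ℚ.≤-Reasoning
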